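{- If $H=(V,E)$ is a $3$-uniform hypergraph and the graph $H_2$ is factor-critical, then $V$ has a partition into one triangle $\{a,b,c\}\in E$ and a perfect matching in $H_2-\{a,b,c\}$.
   Context: A hypergraph $H=(V,E)$ consists of a vertex set $V$ and a family $E$ of subsets of $V$ called hyperedges, where hyperedges may be present with multiplicities. $H$ is $3$-uniform if all of its hyperedges have $3$ elements. A triangle is a hyperedge of cardinality $3$. The graph $H_2=(V,E_2)$ is the simple graph (no loops, no parallel edges) on $V$ whose edges are all $2$-element subsets of hyperedges of $H$. For a graph $G$ and a set $S$ of its vertices, $G-S$ denotes the graph obtained by deleting the vertices in $S$. A matching in a graph is a set of pairwise vertex-disjoint edges; it is perfect if it partitions the vertex set of the graph. A graph $G$ is factor-critical if $G-v$ has a perfect matching for every vertex $v$ of $G$.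
   Formalization: The formal statement assumes that V has at least two vertices; with at most one vertex and no hyperedges, H is vacuously 3-uniform and H_2 is factor-critical by the literal definition, yet there is no triangle, so the claim fails there. -}

module Defs where

open import Data.Nat using (ℕ)
open import Data.Fin.Subset
  using (Subset; _∈_; _⊆_; _∩_; _─_; ⋃; ⁅_⁆; ∣_∣; ⊤; Empty; Nonempty)
open import Data.Fin.Subset.Properties using (⊆⊤)
open import Data.List using (List)
open import Data.List.Membership.Propositional using () renaming (_∈_ to _∈ₗ_)
open import Data.List.Relation.Unary.All using (All)
open import Data.List.Relation.Unary.AllPairs using (AllPairs)
open import Data.Product using (∃-syntax; _×_; _,_; proj₁; proj₂)
open import Relation.Binary.PropositionalEquality using (_≡_)

-- The vertex set is Fin n.  The list gives the hyperedges with their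
-- multiplicities; its order plays no role.
Hypergraph : ℕ → Set
Hypergraph n = List (Subset n)

Uniform : ∀ {n} → ℕ → Hypergraph n → Set
Uniform r H = All (λ h → ∣ h ∣ ≡ r) H

IsTriangle : ∀ {n} → Hypergraph n → Subset n → Set
IsTriangle H t = t ∈ₗ H × ∣ t ∣ ≡ 3

-- A simple graph whose vertex set is a subset of Fin n, so that deleting
-- vertices does not require renumbering.
record Graph (n : ℕ) : Set₁ where
  field
    vertices : Subset n
    IsEdge   : Subset n → Set
    edge-size : ∀ {e} → IsEdge e → ∣ e ∣ ≡ 2
    edge-⊆    : ∀ {e} → IsEdge e → e ⊆ vertices

open Graph public

_₂ : ∀ {n} → Hypergraph n → Graph n
H ₂ = record
  { vertices  = ⊤
  ; IsEdge    = λ e → ∣ e ∣ ≡ 2 × ∃[ h ] (h ∈ₗ H × e ⊆ h)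
  ; edge-size = proj₁
  ; edge-⊆    = λ {e} _ → ⊆⊤ {p = e}
  }

infixl 6 _∖_

_∖_ : ∀ {n} → Graph n → Subset n → Graph n
G ∖ S = record
  { vertices  = vertices G ─ S
  ; IsEdge    = λ e → IsEdge G e × e ⊆ (vertices G ─ S)
  ; edge-size = λ p → edge-size G (proj₁ p)
  ; edge-⊆    = proj₂
  }

Disjoint : ∀ {n} → Subset n → Subset n → Set
Disjoint p q = Empty (p ∩ q)

IsPartition : ∀ {n} → Subset n → List (Subset n) → Set
IsPartition S Ps = All Nonempty Ps × AllPairs Disjoint Ps × ⋃ Ps ≡ S

-- Edges are nonempty, so pairwise disjointness also rules out repetitions:
-- the list represents a set of edges.
IsMatching : ∀ {n} → Graph n → List (Subset n) → Set
IsMatching G M = All (IsEdge G) M × AllPairs Disjoint M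

IsPerfectMatching : ∀ {n} → Graph n → List (Subset n) → Set
IsPerfectMatching G M = IsMatching G M × IsPartition (vertices G) M

-- Graphs with at most one vertex satisfy this trivially: the empty matching is
-- a perfect matching of the graph without vertices.
FactorCritical : ∀ {n} → Graph n → Set
FactorCritical G =
  ∀ v → v ∈ vertices G → ∃[ M ] IsPerfectMatching (G ∖ ⁅ v ⁆) M

{-# OPTIONS --safe #-}

-- Grow a factor-critical set A whose
-- complement is perfectly matched, starting from one vertex, by odd ears: an
-- alternating path between the matching of the complement and a near-perfect
-- matching of the whole graph closes up at A.  When an ear x₁ x₂ … x₂ₘ exhausts
-- the complement, let w be the third vertex of a hyperedge containing x₁ and x₂.
-- If w is in A or w = xⱼ with j odd, then deleting x₁, x₂, w leaves a perfectly
-- matched set.  If j is even, the shorter ear x₁ xⱼ … x₂ₘ can be added to A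
-- instead, which leaves the matched, nonempty set x₂ … xⱼ₋₁ outside.

module Submission where

open import Defs
open import Data.Nat using (ℕ; zero; suc; _<_; _≤_; s≤s)
open import Data.Empty using (⊥; ⊥-elim)
open import Data.Fin using (Fin; zero; suc)
open import Data.Fin.Properties using (suc-injective)
open import Data.Fin.Subset using (Subset; ⊤; inside; outside; _∈_; _⊆_; _∪_; _─_; ⋃; ⁅_⁆; ∣_∣; Nonempty)
  renaming (⊥ to ∅)
open import Data.Fin.Subset.Properties
  using (∈⊤; ⊆⊤; ∣⊤∣≡n; ⊆-antisym; drop-∷-⊆; drop-∷-Empty;
    x∈p∩q⁺; x∈p∩q⁻; x∈p∪q⁺; x∈p∪q⁻; x∈⁅y⁆⇒x≡y; ∉⊥)
open import Data.List using (List; []; _∷_; _++_; length; map)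
open import Data.List.Membership.Propositional using () renaming (_∈_ to _∈ₗ_)
open import Data.List.Membership.Propositional.Properties
  using (∈-∃++; ∈-++⁺ˡ; ∈-++⁺ʳ; ∈-++⁻; ∈-map⁺; ∈-map⁻)
open import Data.List.Properties using (length-++; length-map; map-++)
open import Data.List.Relation.Binary.Permutation.Propositional
  using (_↭_; ↭-refl; ↭-sym; ↭-trans; ↭-prep; ↭-swap; ↭-reflexive; ↭⇒↭ₛ; module PermutationReasoning)
open import Data.List.Relation.Binary.Permutation.Propositional.Properties
  using (∈-resp-↭; ++⁺; ++⁺ˡ; ++⁺ʳ; ++-assoc; ++-comm; ++-identityʳ; drop-∷; map⁺; shift; shifts; ↭-empty-inv; ↭-length)
import Data.List.Relation.Binary.Permutation.Setoid.Properties as SetoidPermutation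
open import Data.List.Relation.Unary.All as All using (All; []; _∷_)
open import Data.List.Relation.Unary.AllPairs using ([]; _∷_)
open import Data.List.Relation.Unary.Any using (here; there)
open import Data.List.Relation.Unary.Unique.Propositional using (Unique)
import Data.List.Relation.Unary.Unique.Propositional.Properties as Unique
open import Data.Nat.Properties using (≤-trans; ≤-reflexive; m≤m+n; m≤n+m; n≤1+n; ≤-refl)
open import Data.Product using (∃-syntax; _×_; ∃₂; _,_; proj₁; proj₂)
open import Data.Sum using (_⊎_; inj₁; inj₂)
open import Data.Vec using ([]; _∷_; here; there)
open import Function using (_∘_)
open import Relation.Binary.PropositionalEquality
  using (_≡_; _≢_; refl; sym; trans; cong; subst; setoid)

extract : ∀ {A : Set} {x : A} {xs} → x ∈ₗ xs → ∃[ ys ] xs ↭ x ∷ ys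
extract x∈xs with as , bs , refl ← ∈-∃++ x∈xs = as ++ bs , shift _ as bs

-- Vertex sets are lists up to permutation.
module TriangleSystem {V : Set}
  (Tri : V → V → V → Set)
  (swap₁₂ : ∀ {a b c} → Tri a b c → Tri b a c)
  (swap₂₃ : ∀ {a b c} → Tri a b c → Tri a c b)
  (distinct : ∀ {a b c} → Tri a b c → c ≢ a × c ≢ b)
  (all : List V) (complete : ∀ v → v ∈ₗ all)
  where

  open PermutationReasoning

  -- Adjacency, matched sets and factor-critical sets.

  Adj : V → V → Set
  Adj a b = ∃[ c ] Tri a b c

  adj-sym : ∀ {a b} → Adj a b → Adj b a
  adj-sym (c , t) = c , swap₁₂ t

  -- A perfect matching of the listed vertices. The permutation carried by `pair` allows the two
  -- matched vertices to stand anywhere in the list.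
  data Matched : List V → Set where
    none : Matched []
    pair : ∀ {a b K L} → Adj a b → Matched K → L ↭ a ∷ b ∷ K → Matched L

  -- Factor-criticality of the graph induced on `A`. Deletion of `v` is expressed by a permutation
  -- of `A` to `v ∷ L`, not by a function on lists.
  Critical : List V → Set
  Critical A = ∀ {v L} → A ↭ v ∷ L → Matched L

  matched-resp-↭ : ∀ {K L} → Matched K → K ↭ L → Matched L
  matched-resp-↭ none p with refl ← ↭-empty-inv (↭-sym p) = none
  matched-resp-↭ (pair e m q) p = pair e m (↭-trans (↭-sym p) q)

  matched-++ : ∀ {K L} → Matched K → Matched L → Matched (K ++ L)
  matched-++ none m = m
  matched-++ (pair e m p) m′ = pair e (matched-++ m m′) (++⁺ʳ _ p)

  mate-∈ : ∀ {x L} → Matched L → x ∈ₗ L → ∃₂ λ y K → Adj x y × L ↭ x ∷ y ∷ K × Matched K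
  mate-∈ (pair e m p) x∈L with ∈-resp-↭ p x∈L
  ... | here refl = _ , _ , e , p , m
  ... | there (here refl) = _ , _ , adj-sym e , ↭-trans p (↭-swap _ _ ↭-refl) , m
  ... | there (there x∈K) with y , K′ , e′ , q , m′ ← mate-∈ m x∈K =
    y , _ , e′ ,
    ↭-trans p (↭-trans (↭-prep _ (↭-prep _ q)) (shifts (_ ∷ _ ∷ []) (_ ∷ y ∷ []))) ,
    pair e m′ ↭-refl

  mate : ∀ {x L} → Matched (x ∷ L) → ∃₂ λ y K → Adj x y × L ↭ y ∷ K × Matched K
  mate m with y , K , e , p , m′ ← mate-∈ m (here refl) = y , K , e , drop-∷ p , m′

  -- Odd ears and alternating paths.

  -- x ∷ P is the inner part of an odd ear, up to the edge from A to x.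
  data Tail (A : List V) : V → List V → Set where
    last : ∀ {x y a} → Adj x y → Adj y a → a ∈ₗ A → Tail A x (y ∷ [])
    more : ∀ {x y z P} → Adj x y → Adj y z → Tail A z P → Tail A x (y ∷ z ∷ P)

  -- Takes every other edge along the tail, beginning with the first.
  tail-matched : ∀ {A x P} → Tail A x P → Matched (x ∷ P)
  tail-matched (last e _ _) = pair e none ↭-refl
  tail-matched (more e _ t) = pair e (tail-matched t) ↭-refl

  -- Takes the complementary edges: `x` is left out, and the last edge reaches `a` in `A`.
  tail-matched-end : ∀ {A x P} → Tail A x P → ∃[ a ] (a ∈ₗ A × Matched (a ∷ P))
  tail-matched-end (last _ e a∈A) = _ , a∈A , pair (adj-sym e) none ↭-refl
  tail-matched-end {P = y ∷ z ∷ P} (more _ e t) with a , a∈A , m ← tail-matched-end t =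
    a , a∈A , pair e m (↭-sym (shift a (y ∷ z ∷ []) P))

  tail-first : ∀ {A x y P} → Tail A x (y ∷ P) → Adj x y
  tail-first (last e _ _) = e
  tail-first (more e _ _) = e

  tail-rest : ∀ {A x y P} → Tail A x (y ∷ P) → Matched P
  tail-rest (last _ _ _) = none
  tail-rest (more _ _ t) = tail-matched t

  tail-exit : ∀ {A x P} → Tail A x P → ∃₂ λ u a → u ∈ₗ x ∷ P × a ∈ₗ A × Adj a u
  tail-exit (last _ e a∈A) = _ , _ , there (here refl) , a∈A , adj-sym e
  tail-exit (more _ _ t) with u , a , u∈ , a∈A , e ← tail-exit t =
    u , a , there (there u∈) , a∈A , e

  -- Positions are counted from `x`, which has position 1. Deleting `w` at an odd position leaves a
  -- matched piece before it and an odd piece after it, matched with the help of the end `a` in `A`.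
  -- At an even position the odd piece `S` comes first and needs a neighbour `u` of `x`, while `K`
  -- is matched by itself. The clause producing a `Tail` makes a shortcut to `w` possible from any
  -- of its neighbours.
  AtOdd AtEven : List V → V → List V → V → Set
  AtOdd A x P w = ∃₂ λ a Q → a ∈ₗ A × x ∷ P ↭ w ∷ Q × Matched (a ∷ Q)
  AtEven A x P w = ∃₂ λ S K → x ∷ P ↭ S ++ w ∷ K
    × (∀ {u} → Adj u x → Matched (u ∷ S))
    × (∀ {u} → Adj u w → Tail A u (w ∷ K))
    × Matched K

  split : ∀ {A x P w} → Tail A x P → w ∈ₗ x ∷ P → AtOdd A x P w ⊎ AtEven A x P w
  split t (here refl) with a , a∈A , m ← tail-matched-end t =
    inj₁ (a , _ , a∈A , ↭-refl , m)
  split {x = x} (last e e′ a∈A) (there (here refl)) =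
    inj₂ (x ∷ [] , [] , ↭-refl , (λ f → pair f none ↭-refl) , (λ f → last f e′ a∈A) , none)
  split {x = x} (more e e′ t) (there (here refl)) =
    inj₂ (x ∷ [] , _ , ↭-refl , (λ f → pair f none ↭-refl) , (λ f → more f e′ t) , tail-matched t)
  -- Two vertices are peeled off at a time, so parity is the same along `t` as along the whole tail.
  split {x = x} {P = y ∷ _} (more e e′ t) (there (there w∈)) with split t w∈
  ... | inj₁ (a , Q , a∈A , p , m) =
    inj₁ (a , x ∷ y ∷ Q , a∈A ,
      ↭-trans (↭-prep x (↭-prep y p)) (shift _ (x ∷ y ∷ []) Q) ,
      pair e m (↭-sym (shift a (x ∷ y ∷ []) Q)))
  ... | inj₂ (S , K , p , mS , tK , mK) =
    inj₂ (x ∷ y ∷ S , K , ↭-prep x (↭-prep y p) , (λ f → pair f (mS e′) ↭-refl) , tK , mK)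

  -- Deleting a vertex of the ear leaves an even piece, matched by itself, and an odd piece, which
  -- borrows its end in `A`; the rest of `A` is matched by criticality. No case borrows both ends,
  -- so the ends of the ear may coincide.
  ear-critical : ∀ {A a x P} → Critical A → a ∈ₗ A → Adj a x → Tail A x P → Critical (A ++ x ∷ P)
  ear-critical {A} {a} {x} {P} crit a∈A e t {v} {L} p with ∈-++⁻ A (∈-resp-↭ (↭-sym p) (here refl))
  ... | inj₁ v∈A with A₀ , q ← extract v∈A =
    matched-resp-↭ (matched-++ (crit q) (tail-matched t)) (drop-∷ (↭-trans (++⁺ʳ _ (↭-sym q)) p))
  ... | inj₂ v∈P = by-parity (split t v∈P)
    where
    by-parity : AtOdd A x P v ⊎ AtEven A x P v → Matched L
    by-parity (inj₁ (b , Q , b∈A , r , m)) with A₀ , q ← extract b∈A =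
      matched-resp-↭ (matched-++ (crit q) m) (drop-∷ (begin
        v ∷ A₀ ++ b ∷ Q    ↭⟨ ↭-prep v (shift b A₀ Q) ⟩
        v ∷ b ∷ A₀ ++ Q    ↭⟨ shift v (b ∷ A₀) Q ⟨
        b ∷ A₀ ++ v ∷ Q    ↭⟨ ++⁺ q r ⟨
        A ++ x ∷ P         ↭⟨ p ⟩
        v ∷ L              ∎))
    by-parity (inj₂ (S , K , r , mS , _ , mK)) with A₀ , q ← extract a∈A =
      matched-resp-↭ (matched-++ (crit q) (matched-++ (mS e) mK)) (drop-∷ (begin
        v ∷ A₀ ++ a ∷ S ++ K    ↭⟨ ↭-prep v (shift a A₀ (S ++ K)) ⟩
        v ∷ a ∷ A₀ ++ S ++ K    ↭⟨ shift v (a ∷ A₀) (S ++ K) ⟨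
        a ∷ A₀ ++ v ∷ S ++ K    ↭⟨ ++⁺ˡ (a ∷ A₀) (shift v S K) ⟨
        a ∷ A₀ ++ S ++ v ∷ K    ↭⟨ ++⁺ q r ⟨
        A ++ x ∷ P              ↭⟨ p ⟩
        v ∷ L                   ∎))

  -- Follows the edges of the two given matchings alternately, starting from x
  -- and deleting the visited vertices from both, until A is reached.
  alternating-path : ∀ n {A x R} → length R < n → Matched (x ∷ R) → Matched (A ++ R) →
    ∃₂ λ P R′ → Tail A x P × R ↭ P ++ R′ × Matched R′
  alternating-path (suc n) {A} {x} {R} (s≤s ℓ) mR mAR
    with y , R₁ , e , p , m₁ ← mate mR
    -- The second matching covers `A ++ R`, from which `x` and all earlier path vertices are absent.
    -- Hence `z` is either in `A`, closing the path, or unvisited, and then it takes over the role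
    -- of `x`.
    with z , K , e′ , q , mK ← mate (matched-resp-↭ mAR (↭-trans (++⁺ˡ A p) (shift y A R₁)))
    with ∈-++⁻ A (∈-resp-↭ (↭-sym q) (here refl))
  ... | inj₁ z∈A = y ∷ [] , R₁ , last e e′ z∈A , p , m₁
  ... | inj₂ z∈R₁
    with R₂ , r ← extract z∈R₁
    with P , R′ , t , s , m′ ← alternating-path n {A}
           (≤-trans (n≤1+n _) (≤-trans (≤-reflexive (sym (↭-length (↭-trans p (↭-prep y r))))) ℓ))
           (matched-resp-↭ m₁ r)
           (matched-resp-↭ mK (drop-∷ (↭-trans (↭-sym q) (↭-trans (++⁺ˡ A r) (shift z A R₂)))))
    = y ∷ z ∷ P , R′ , more e e′ t , ↭-trans p (↭-prep y (↭-trans r (↭-prep z s))) , m′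

  -- Growing a factor-critical set until a triangle splits off.

  TriangleAndMatching : Set
  TriangleAndMatching = ∃₂ λ a b → ∃₂ λ c L → Tri a b c × all ↭ a ∷ b ∷ c ∷ L × Matched L

  -- The complement is written `r ∷ R` to keep it nonempty, so that growth can end only with a
  -- triangle.
  SmallerComplement : ℕ → Set
  SmallerComplement n =
    ∃₂ λ A r → ∃[ R ] (Critical A × Matched (r ∷ R) × all ↭ A ++ r ∷ R × length (r ∷ R) < n)

  spanning-ear : ∀ {A a x P} → Critical A → a ∈ₗ A → Adj a x → Tail A x P → all ↭ A ++ x ∷ P →
    TriangleAndMatching ⊎ SmallerComplement (length (x ∷ P))
  spanning-ear {A} {a} {x} {y ∷ P} crit a∈A e t p = by-third-vertex (tail-first t)
    where
    third-in-A : ∀ {w} → Tri x y w → w ∈ₗ A → TriangleAndMatching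
    third-in-A {w} tri w∈A with A₀ , q ← extract w∈A =
      x , y , w , A₀ ++ P , tri ,
      ↭-trans p (↭-trans (++⁺ʳ _ q) (shifts (w ∷ A₀) (x ∷ y ∷ []))) ,
      matched-++ (crit q) (tail-rest t)

    third-at-odd : ∀ {w b Q} → Tri x y w → b ∈ₗ A → P ↭ w ∷ Q → Matched (b ∷ Q) → TriangleAndMatching
    third-at-odd {w} {b} {Q} tri b∈A r m with A₀ , q ← extract b∈A =
      x , y , w , A₀ ++ b ∷ Q , tri ,
      (begin
        all                            ↭⟨ p ⟩
        A ++ x ∷ y ∷ P                 ↭⟨ ++⁺ q (↭-prep x (↭-prep y r)) ⟩
        (b ∷ A₀) ++ x ∷ y ∷ w ∷ Q      ↭⟨ shifts (b ∷ A₀) (x ∷ y ∷ w ∷ []) ⟩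
        x ∷ y ∷ w ∷ b ∷ A₀ ++ Q        ↭⟨ ++⁺ˡ (x ∷ y ∷ w ∷ []) (shift b A₀ Q) ⟨
        x ∷ y ∷ w ∷ A₀ ++ b ∷ Q        ∎) ,
      matched-++ (crit q) m

    third-at-even : ∀ {w S K} → Tri x y w → P ↭ S ++ w ∷ K → Matched (y ∷ S) → Tail A x (w ∷ K) →
      SmallerComplement (length (x ∷ y ∷ P))
    third-at-even {w} {S} {K} tri r mS tK =
      -- The shortcut from `x` to `w` along the same hyperedge keeps the ear odd, and the bypassed
      -- vertices `y ∷ S` form the new complement.
      A ++ x ∷ w ∷ K , y , S , ear-critical crit a∈A e tK , mS ,
      (begin
        all                            ↭⟨ p ⟩
        A ++ x ∷ y ∷ P                 ↭⟨ ++⁺ˡ A (↭-prep x (↭-prep y r)) ⟩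
        A ++ x ∷ y ∷ S ++ w ∷ K        ↭⟨ ++⁺ˡ A (↭-prep x (++-comm (y ∷ S) (w ∷ K))) ⟩
        A ++ x ∷ w ∷ K ++ y ∷ S        ↭⟨ ++-assoc A (x ∷ w ∷ K) (y ∷ S) ⟨
        (A ++ x ∷ w ∷ K) ++ y ∷ S      ∎) ,
      s≤s (s≤s (≤-trans (m≤m+n (length S) _)
        (≤-reflexive (sym (trans (↭-length r) (length-++ S))))))

    on-ear : ∀ {w} → Tri x y w → w ∈ₗ P → Tail A x (y ∷ P) →
      TriangleAndMatching ⊎ SmallerComplement (length (x ∷ y ∷ P))
    -- The tail `t′` starts two vertices after `x`, so parities agree. In the even case `e′` joins
    -- `y` to the start of `S`, and the hyperedge itself supplies the adjacency of `x` and `w`.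
    on-ear tri w∈P (more _ e′ t′) with split t′ w∈P
    ... | inj₁ (_ , _ , b∈A , r , m) = inj₁ (third-at-odd tri b∈A r m)
    ... | inj₂ (_ , _ , r , mS , tK , _) =
      inj₂ (third-at-even tri r (mS e′) (tK (y , swap₂₃ tri)))

    by-third-vertex : Adj x y → TriangleAndMatching ⊎ SmallerComplement (length (x ∷ y ∷ P))
    by-third-vertex (w , tri) with ∈-++⁻ A (∈-resp-↭ p (complete w))
    ... | inj₁ w∈A = inj₁ (third-in-A tri w∈A)
    ... | inj₂ (here w≡x) = ⊥-elim (proj₁ (distinct tri) w≡x)
    ... | inj₂ (there (here w≡y)) = ⊥-elim (proj₂ (distinct tri) w≡y)
    ... | inj₂ (there (there w∈P)) = on-ear tri w∈P t

  -- If matched vertices remain outside the ear, they are the new complement; otherwise the ear is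
  -- spanning and the third vertex of a hyperedge is needed.
  add-ear : ∀ {A a x P R} R′ → Critical A → a ∈ₗ A → Adj a x → Tail A x P →
    all ↭ A ++ R → R ↭ x ∷ P ++ R′ → Matched R′ →
    TriangleAndMatching ⊎ SmallerComplement (length R)
  add-ear {A} {x = x} {P} [] crit a∈A e t p u _ with u′ ← ↭-trans u (++-identityʳ (x ∷ P)) =
    subst (λ k → TriangleAndMatching ⊎ SmallerComplement k) (sym (↭-length u′))
      (spanning-ear crit a∈A e t (↭-trans p (++⁺ˡ A u′)))
  add-ear {A} {x = x} {P} (r ∷ R′) crit a∈A e t p u m =
    inj₂ (A ++ x ∷ P , r , R′ , ear-critical crit a∈A e t , m ,
      ↭-trans p (↭-trans (++⁺ˡ A u) (↭-sym (++-assoc A (x ∷ P) (r ∷ R′)))) ,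
      subst (length (r ∷ R′) <_)
        (sym (trans (↭-length u) (cong suc (length-++ P))))
        (s≤s (m≤n+m _ (length P))))

  -- The two matchings are that of the complement and the one of the whole graph without `x`.
  path-to : ∀ {A x R R₁} → Critical all → Matched R → all ↭ A ++ R → R ↭ x ∷ R₁ →
    ∃₂ λ P R′ → Tail A x P × R₁ ↭ P ++ R′ × Matched R′
  path-to {A} {x} {R₁ = R₁} critAll m p q =
    alternating-path _ {A} ≤-refl (matched-resp-↭ m q)
      (critAll (↭-trans p (↭-trans (++⁺ˡ A q) (shift x A R₁))))

  -- Replaces a connectedness argument: an alternating path from any outside vertex must enter `A`,
  -- and its last edge crosses.
  crossing-edge : ∀ {A r R} → Critical all → Matched (r ∷ R) → all ↭ A ++ r ∷ R →
    ∃₂ λ a x → a ∈ₗ A × Adj a x × x ∈ₗ r ∷ R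
  crossing-edge {r = r} critAll m p = exit (path-to critAll m p ↭-refl)
    where
    exit : ∀ {A R} → (∃₂ λ P R′ → Tail A r P × R ↭ P ++ R′ × Matched R′) →
      ∃₂ λ a x → a ∈ₗ A × Adj a x × x ∈ₗ r ∷ R
    exit (_ , _ , t , s , _) with x , a , x∈P , a∈A , e ← tail-exit t =
      a , x , a∈A , e , ∈-resp-↭ (↭-prep r (↭-sym s)) (∈-++⁺ˡ x∈P)

  grow : Critical all → ∀ {A r R} → Critical A → Matched (r ∷ R) → all ↭ A ++ r ∷ R →
    TriangleAndMatching ⊎ SmallerComplement (length (r ∷ R))
  grow critAll crit m p =
    -- The path behind the crossing edge may start far from `A`. A second path is therefore started
    -- at `x`, a neighbour of `a`, so that both ends of the ear are attached to `A`.
    let a , x , a∈A , e , x∈R = crossing-edge critAll m p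
        _ , q = extract x∈R
        _ , R′ , t , s , m′ = path-to critAll m p q
    in add-ear R′ crit a∈A e t p (↭-trans q (↭-prep x s)) m′

  -- Recursion on the bound `n` for the size of the complement, which drops with every ear.
  exhaust : Critical all → ∀ n {A r R} → length (r ∷ R) < n →
    Critical A → Matched (r ∷ R) → all ↭ A ++ r ∷ R → TriangleAndMatching
  exhaust critAll (suc n) {R = R} (s≤s ℓ) crit m p = continue (grow critAll crit m p)
    where
    continue : TriangleAndMatching ⊎ SmallerComplement (suc (length R)) → TriangleAndMatching
    continue (inj₁ done) = done
    continue (inj₂ (_ , _ , _ , crit′ , m′ , p′ , ℓ′)) =
      exhaust critAll n (≤-trans ℓ′ ℓ) crit′ m′ p′

  triangle-and-matching : ∀ {u v R} → all ↭ u ∷ v ∷ R → Critical all → TriangleAndMatching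
  triangle-and-matching {u} p critAll =
    exhaust critAll _ ≤-refl singleton-critical (critAll p) p
    where
    singleton-critical : Critical (u ∷ [])
    singleton-critical {L = []} _ = none
    singleton-critical {L = _ ∷ _} q with () ← ↭-length q

-- Subsets as lists without repetitions.

unique-resp-↭ : ∀ {A : Set} {xs ys : List A} → Unique xs → xs ↭ ys → Unique ys
unique-resp-↭ u p = SetoidPermutation.Unique-resp-↭ (setoid _) (↭⇒↭ₛ p) u

unique-++-disjoint : ∀ {A : Set} {x : A} xs {ys} → Unique (xs ++ ys) → x ∈ₗ xs → x ∈ₗ ys → ⊥
unique-++-disjoint (_ ∷ xs) (x∉ ∷ _) (here refl) x∈ys = All.lookup x∉ (∈-++⁺ʳ xs x∈ys) refl
unique-++-disjoint (_ ∷ xs) (_ ∷ u) (there x∈xs) x∈ys = unique-++-disjoint xs u x∈xs x∈ys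

elements : ∀ {n} → Subset n → List (Fin n)
elements [] = []
elements (inside ∷ p) = zero ∷ map suc (elements p)
elements (outside ∷ p) = map suc (elements p)

∈-elements⁺ : ∀ {n x} {p : Subset n} → x ∈ p → x ∈ₗ elements p
∈-elements⁺ here = here refl
∈-elements⁺ {p = inside ∷ _} (there x∈p) = there (∈-map⁺ suc (∈-elements⁺ x∈p))
∈-elements⁺ {p = outside ∷ _} (there x∈p) = ∈-map⁺ suc (∈-elements⁺ x∈p)

∈-elements⁻ : ∀ {n x} (p : Subset n) → x ∈ₗ elements p → x ∈ p
∈-elements⁻ (inside ∷ p) (here refl) = here
∈-elements⁻ (inside ∷ p) (there x∈) with _ , y∈ , refl ← ∈-map⁻ suc x∈ = there (∈-elements⁻ p y∈)
∈-elements⁻ (outside ∷ p) x∈ with _ , y∈ , refl ← ∈-map⁻ suc x∈ = there (∈-elements⁻ p y∈)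

elements-unique : ∀ {n} (p : Subset n) → Unique (elements p)
elements-unique [] = []
elements-unique (inside ∷ p) = All.tabulate 0≢ ∷ Unique.map⁺ suc-injective (elements-unique p)
  where
  0≢ : ∀ {x} → x ∈ₗ map suc (elements p) → zero ≢ x
  0≢ x∈ refl with () ← proj₂ (proj₂ (∈-map⁻ suc x∈))
elements-unique (outside ∷ p) = Unique.map⁺ suc-injective (elements-unique p)

length-elements : ∀ {n} (p : Subset n) → length (elements p) ≡ ∣ p ∣
length-elements [] = refl
length-elements (inside ∷ p) = cong suc (trans (length-map suc (elements p)) (length-elements p))
length-elements (outside ∷ p) = trans (length-map suc (elements p)) (length-elements p)

-- Turns permutations of lists back into equalities of subsets.
elements-injective : ∀ {n} {p q : Subset n} → elements p ↭ elements q → p ≡ q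
elements-injective {p = p} {q} r = ⊆-antisym
  (∈-elements⁻ q ∘ ∈-resp-↭ r ∘ ∈-elements⁺)
  (∈-elements⁻ p ∘ ∈-resp-↭ (↭-sym r) ∘ ∈-elements⁺)

map-suc-++ : ∀ {n} {xs : List (Fin n)} ys {zs} → xs ↭ ys ++ zs →
  map Fin.suc xs ↭ map Fin.suc ys ++ map Fin.suc zs
map-suc-++ ys {zs} p = ↭-trans (map⁺ Fin.suc p) (↭-reflexive (map-++ Fin.suc ys zs))

elements-∪ : ∀ {n} (p q : Subset n) → Disjoint p q → elements (p ∪ q) ↭ elements p ++ elements q
elements-∪ [] [] _ = ↭-refl
elements-∪ (inside ∷ p) (inside ∷ q) d = ⊥-elim (d (zero , here))
elements-∪ (inside ∷ p) (outside ∷ q) d =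
  ↭-prep zero (map-suc-++ (elements p) (elements-∪ p q (drop-∷-Empty d)))
elements-∪ (outside ∷ p) (inside ∷ q) d =
  ↭-trans (↭-prep zero (map-suc-++ (elements p) (elements-∪ p q (drop-∷-Empty d))))
    (↭-sym (shift zero (map suc (elements p)) _))
elements-∪ (outside ∷ p) (outside ∷ q) d =
  map-suc-++ (elements p) (elements-∪ p q (drop-∷-Empty d))

elements-─ : ∀ {n} (p q : Subset n) → q ⊆ p → elements p ↭ elements q ++ elements (p ─ q)
elements-─ [] [] _ = ↭-refl
elements-─ (inside ∷ p) (inside ∷ q) s =
  ↭-prep zero (map-suc-++ (elements q) (elements-─ p q (drop-∷-⊆ s)))
elements-─ (inside ∷ p) (outside ∷ q) s =
  ↭-trans (↭-prep zero (map-suc-++ (elements q) (elements-─ p q (drop-∷-⊆ s))))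
    (↭-sym (shift zero (map suc (elements q)) _))
elements-─ (outside ∷ p) (inside ∷ q) s with () ← s here
elements-─ (outside ∷ p) (outside ∷ q) s =
  map-suc-++ (elements q) (elements-─ p q (drop-∷-⊆ s))

elements-⊥ : ∀ n → elements (∅ {n}) ≡ []
elements-⊥ zero = refl
elements-⊥ (suc n) = cong (map suc) (elements-⊥ n)

elements-⁅⁆ : ∀ {n} (x : Fin n) → elements ⁅ x ⁆ ≡ x ∷ []
elements-⁅⁆ {suc n} zero = cong (λ xs → zero ∷ map suc xs) (elements-⊥ n)
elements-⁅⁆ (suc x) = cong (map suc) (elements-⁅⁆ x)

elements-pair : ∀ {n} {a b : Fin n} → a ≢ b → elements (⁅ a ⁆ ∪ ⁅ b ⁆) ↭ a ∷ b ∷ []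
elements-pair {a = a} {b} a≢b
  with p ← elements-∪ ⁅ a ⁆ ⁅ b ⁆ (λ (x , x∈) → let x∈a , x∈b = x∈p∩q⁻ ⁅ a ⁆ ⁅ b ⁆ x∈ in
                 a≢b (trans (sym (x∈⁅y⁆⇒x≡y a x∈a)) (x∈⁅y⁆⇒x≡y b x∈b)))
  rewrite elements-⁅⁆ a | elements-⁅⁆ b = p

-- A common element would occur twice in `L`. This recovers the disjointness that `Matched` does not
-- record.
elements-disjoint : ∀ {n} (p q : Subset n) {L} → Unique L → L ↭ elements p ++ elements q → Disjoint p q
elements-disjoint p q u r (x , x∈) =
  let x∈p , x∈q = x∈p∩q⁻ p q x∈ in
  unique-++-disjoint (elements p) (unique-resp-↭ u r) (∈-elements⁺ x∈p) (∈-elements⁺ x∈q)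

∈-⋃ : ∀ {n x} {p : Subset n} {Ps} → p ∈ₗ Ps → x ∈ p → x ∈ ⋃ Ps
∈-⋃ (here refl) x∈p = x∈p∪q⁺ (inj₁ x∈p)
∈-⋃ (there p∈) x∈p = x∈p∪q⁺ (inj₂ (∈-⋃ p∈ x∈p))

disjoint-⋃⁺ : ∀ {n} {p : Subset n} {Ps} → All (Disjoint p) Ps → Disjoint p (⋃ Ps)
disjoint-⋃⁺ {p = p} {[]} [] (_ , x∈) = ∉⊥ (proj₂ (x∈p∩q⁻ p _ x∈))
disjoint-⋃⁺ {p = p} {q ∷ Ps} (d ∷ ds) (x , x∈) with x∈p , x∈⋃ ← x∈p∩q⁻ p _ x∈ with x∈p∪q⁻ q _ x∈⋃
... | inj₁ x∈q = d (x , x∈p∩q⁺ (x∈p , x∈q))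
... | inj₂ x∈Ps = disjoint-⋃⁺ ds (x , x∈p∩q⁺ (x∈p , x∈Ps))

disjoint-⋃⁻ : ∀ {n} {p : Subset n} {Ps} → Disjoint p (⋃ Ps) → All (Disjoint p) Ps
disjoint-⋃⁻ {p = p} d = All.tabulate λ {q} q∈ (x , x∈) →
  let x∈p , x∈q = x∈p∩q⁻ p q x∈ in d (x , x∈p∩q⁺ (x∈p , ∈-⋃ q∈ x∈q))

-- Translation between the hypergraph and the triangle system.

module _ {n} (H : Hypergraph n) (uniform : Uniform 3 H) where

  Tri : Fin n → Fin n → Fin n → Set
  Tri a b c = ∃[ h ] (h ∈ₗ H × elements h ↭ a ∷ b ∷ c ∷ [])

  tri-swap₁₂ : ∀ {a b c} → Tri a b c → Tri b a c
  tri-swap₁₂ (h , h∈ , p) = h , h∈ , ↭-trans p (↭-swap _ _ ↭-refl)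

  tri-swap₂₃ : ∀ {a b c} → Tri a b c → Tri a c b
  tri-swap₂₃ (h , h∈ , p) = h , h∈ , ↭-trans p (↭-prep _ (↭-swap _ _ ↭-refl))

  tri-unique : ∀ {a b c} → Tri a b c → Unique (a ∷ b ∷ c ∷ [])
  tri-unique (h , _ , p) = unique-resp-↭ (elements-unique h) p

  tri-distinct : ∀ {a b c} → Tri a b c → c ≢ a × c ≢ b
  tri-distinct t with (_ ∷ a≢c ∷ []) ∷ (b≢c ∷ []) ∷ _ ← tri-unique t = a≢c ∘ sym , b≢c ∘ sym

  open TriangleSystem Tri tri-swap₁₂ tri-swap₂₃ tri-distinct (elements ⊤) (λ _ → ∈-elements⁺ ∈⊤)

  edge⇒adj : ∀ {e} → IsEdge (H ₂) e → ∃₂ λ a b → Adj a b × elements e ≡ a ∷ b ∷ []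
  edge⇒adj {e} (∣e∣≡2 , h , h∈ , e⊆h) =
    go (elements e) (elements (h ─ e)) (trans (length-elements e) ∣e∣≡2)
      (trans (length-elements h) (All.lookup uniform h∈)) (elements-─ h e e⊆h)
    where
    -- Both element lists are generalized so that their lengths fix their shapes; the single entry
    -- of `ys` is the third vertex of `h`.
    go : ∀ xs ys → length xs ≡ 2 → length (elements h) ≡ 3 → elements h ↭ xs ++ ys →
      ∃₂ λ a b → Adj a b × xs ≡ a ∷ b ∷ []
    go (a ∷ b ∷ []) (c ∷ []) _ _ p = a , b , (c , h , h∈ , p) , refl
    go (_ ∷ _ ∷ []) [] _ ∣h∣≡3 p with () ← trans (sym ∣h∣≡3) (↭-length p)
    go (_ ∷ _ ∷ []) (_ ∷ _ ∷ _) _ ∣h∣≡3 p with () ← trans (sym ∣h∣≡3) (↭-length p)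

  adj⇒edge : ∀ {a b} → Adj a b → IsEdge (H ₂) (⁅ a ⁆ ∪ ⁅ b ⁆) × elements (⁅ a ⁆ ∪ ⁅ b ⁆) ↭ a ∷ b ∷ []
  adj⇒edge {a} {b} (c , t@(h , h∈ , p)) with (a≢b ∷ _) ∷ _ ← tri-unique t =
    (trans (sym (length-elements (⁅ a ⁆ ∪ ⁅ b ⁆))) (↭-length q) , h , h∈ ,
      ∈-elements⁻ h ∘ ∈-resp-↭ (↭-sym p) ∘ ∈-++⁺ˡ ∘ ∈-resp-↭ q ∘ ∈-elements⁺) , q
    where
    q : elements (⁅ a ⁆ ∪ ⁅ b ⁆) ↭ a ∷ b ∷ []
    q = elements-pair a≢b

  matching⇒matched : ∀ {M} → IsMatching (H ₂) M → Matched (elements (⋃ M))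
  matching⇒matched {[]} _ = subst Matched (sym (elements-⊥ n)) none
  matching⇒matched {e ∷ M} (edge ∷ edges , d ∷ ds) with a , b , adj , eq ← edge⇒adj edge =
    pair adj (matching⇒matched (edges , ds))
      (subst (λ xs → elements (⋃ (e ∷ M)) ↭ xs ++ elements (⋃ M)) eq
        (elements-∪ e (⋃ M) (disjoint-⋃⁺ d)))

  -- The absence of repetitions in `L` makes the edges pairwise disjoint.
  matched⇒matching : ∀ {L} → Matched L → Unique L → ∃[ M ] (IsMatching (H ₂) M × elements (⋃ M) ↭ L)
  matched⇒matching none _ = [] , ([] , []) , ↭-reflexive (elements-⊥ n)
  matched⇒matching {L} (pair {a} {b} {K} adj m p) u
    with _ ∷ _ ∷ uK ← unique-resp-↭ u p
    with M , (edges , ds) , q ← matched⇒matching m uK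
    with edge , r ← adj⇒edge adj =
    e ∷ M , (edge ∷ edges , disjoint-⋃⁻ d ∷ ds) , ↭-trans (elements-∪ e (⋃ M) d) (↭-sym s)
    where
    e = ⁅ a ⁆ ∪ ⁅ b ⁆
    s : L ↭ elements e ++ elements (⋃ M)
    s = ↭-trans p (++⁺ (↭-sym r) (↭-sym q))
    d : Disjoint e (⋃ M)
    d = elements-disjoint e (⋃ M) u s

  factorCritical⇒critical : FactorCritical (H ₂) → Critical (elements ⊤)
  factorCritical⇒critical fc {v} {L} p
    with M , (edges , ds) , _ , _ , ⋃M≡ ← fc v ∈⊤ =
    matched-resp-↭ (matching⇒matched (All.map proj₁ edges , ds)) (drop-∷ (begin
      v ∷ elements (⋃ M)                  ≡⟨ cong (λ q → v ∷ elements q) ⋃M≡ ⟩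
      v ∷ elements (⊤ ─ ⁅ v ⁆)            ≡⟨ cong (_++ elements (⊤ ─ ⁅ v ⁆)) (elements-⁅⁆ v) ⟨
      elements ⁅ v ⁆ ++ elements (⊤ ─ ⁅ v ⁆) ↭⟨ elements-─ ⊤ ⁅ v ⁆ ⊆⊤ ⟨
      elements ⊤                          ↭⟨ p ⟩
      v ∷ L                               ∎))
    where open PermutationReasoning

  edge-nonempty : ∀ {e} → IsEdge (H ₂) e → Nonempty e
  edge-nonempty {e} edge with a , _ , _ , eq ← edge⇒adj edge =
    a , ∈-elements⁻ e (subst (a ∈ₗ_) (sym eq) (here refl))

  triangle-partition : TriangleAndMatching →
    ∃[ t ] ∃[ M ] (IsTriangle H t × IsPerfectMatching (H ₂ ∖ t) M × IsPartition ⊤ (t ∷ M))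
  triangle-partition (a , b , c , L , (t , t∈ , q) , p , m)
    with _ ∷ _ ∷ _ ∷ uL ← unique-resp-↭ (elements-unique ⊤) p
    with M , (edges , ds) , r ← matched⇒matching m uL =
    t , M , (t∈ , All.lookup uniform t∈) ,
    -- The edges of `M` survive the deletion of `t` because they lie in `⋃ M`, which equals `⊤ ─ t`.
    ((All.tabulate (λ e∈ → All.lookup edges e∈ , λ x∈e → subst (_ ∈_) ⋃M≡ (∈-⋃ e∈ x∈e)) , ds) ,
      nonempty , ds , ⋃M≡) ,
    (a , ∈-elements⁻ t (∈-resp-↭ (↭-sym q) (here refl))) ∷ nonempty ,
    disjoint-⋃⁻ d ∷ ds ,
    elements-injective (↭-trans (elements-∪ t (⋃ M) d) (↭-sym s))
    where
    s : elements ⊤ ↭ elements t ++ elements (⋃ M)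
    s = ↭-trans p (++⁺ (↭-sym q) (↭-sym r))
    d : Disjoint t (⋃ M)
    d = elements-disjoint t (⋃ M) (elements-unique ⊤) s
    nonempty : All Nonempty M
    nonempty = All.map edge-nonempty edges
    ⋃M≡ : ⋃ M ≡ ⊤ ─ t
    -- Both sides complete `t` to `⊤`, so the three vertices of `t` can be cancelled.
    ⋃M≡ = elements-injective (drop-∷ (drop-∷ (drop-∷ (begin
      a ∷ b ∷ c ∷ elements (⋃ M)       ↭⟨ ++⁺ʳ _ q ⟨
      elements t ++ elements (⋃ M)     ↭⟨ s ⟨
      elements ⊤                       ↭⟨ elements-─ ⊤ t ⊆⊤ ⟩
      elements t ++ elements (⊤ ─ t)   ↭⟨ ++⁺ʳ _ q ⟩
      a ∷ b ∷ c ∷ elements (⊤ ─ t)     ∎))))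
      where open PermutationReasoning

  partition : 1 < n → FactorCritical (H ₂) →
    ∃[ t ] ∃[ M ] (IsTriangle H t × IsPerfectMatching (H ₂ ∖ t) M × IsPartition ⊤ (t ∷ M))
  partition 1<n fc =
    triangle-partition (two-vertices _ ↭-refl
      (subst (1 <_) (sym (trans (length-elements (⊤ {n})) (∣⊤∣≡n n))) 1<n))
    where
    -- Generalizing `elements ⊤` to `xs` exposes two vertices: one starts the critical set, the
    -- other shows that its complement is nonempty.
    two-vertices : ∀ xs → elements ⊤ ↭ xs → 1 < length xs → TriangleAndMatching
    two-vertices (_ ∷ _ ∷ _) p _ = triangle-and-matching p (factorCritical⇒critical fc)
    two-vertices (_ ∷ []) _ (s≤s ())

lemma2p2 : ∀ (n : ℕ) (H : Hypergraph n) →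
    1 < n →
    Uniform 3 H →
    FactorCritical (H ₂) →
    ∃[ t ] ∃[ M ] (IsTriangle H t × IsPerfectMatching (H ₂ ∖ t) M × IsPartition ⊤ (t ∷ M))
lemma2p2 n H 1<n uniform fc = partition H uniform 1<n fc
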